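{- Let $a$ and $n$ be positive integers and let $S=\{x_1,\dots,x_n\}$ be a factor closed set of $n$ distinct positive integers, indexed so that $x_1=1$. Let $B_a=(b_{ij})_{1\le i,j\le n}$ be the matrix with $b_{ij}=\mu\left(\frac{x_j}{x_i}\right)\left(\frac{x_j}{x_i}\right)^a$ if $x_i\mid x_j$ and $b_{ij}=0$ otherwise. Then $$B_a^T\,\big([x_i,x_j]^a\big)\,B_a=\operatorname{diag}\Big(1,\ \prod_{p\mid x_2}\big(p^{a\nu_p(x_2)}-p^{a(\nu_p(x_2)+1)}\big),\ \dots,\ \prod_{p\mid x_n}\big(p^{a\nu_p(x_n)}-p^{a(\nu_p(x_n)+1)}\big)\Big),$$ where the products run over the primes $p$ dividing the indicated integer.
   Context: $[x,y]$ denotes the least common multiple of $x$ and $y$, and $([x_i,x_j]^a)$ denotes the $n\times n$ matrix whose $(i,j)$-entry is $[x_i,x_j]^a$. A set $S$ of positive integers is factor closed if every positive divisor of every element of $S$ lies in $S$. $\mu$ is the Möbius function and $\nu_p(x)$ is the $p$-adic valuation of $x$. -}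

module Defs where

open import Data.Bool.Base using (if_then_else_)
import Data.Fin.Properties as Fin
open import Data.Integer.Base using (ℤ; +_; 0ℤ; 1ℤ; -1ℤ; _-_) renaming (_*_ to _*ᶻ_; _^_ to _^ᶻ_)
open import Data.Integer.Properties using (+-*-semiring)
open import Data.List.Base using (List; filter; foldr; length; map; upTo)
open import Data.List.Relation.Unary.All using (all?)
open import Data.Nat.Base using (ℕ; zero; suc; _+_; _*_; _^_; _<_)
open import Data.Nat.Divisibility using (_∣_; _∣?_; quotient)
open import Data.Nat.LCM using (lcm)
open import Data.Nat.Primality using (prime?)
open import Data.Product.Base using (∃)
open import Data.Vec.Functional using (Vector)
open import Relation.Binary.PropositionalEquality using (_≡_)
open import Relation.Nullary.Decidable using (yes; no; does; ¬?; _×-dec_)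
open import Relation.Unary using (Pred; _∈_)
open import Level using (0ℓ)

open import Algebra.Properties.Semiring.Sum +-*-semiring using (sum)

-- For n = 0 this is the empty list; it is only applied to positive n.
primeDivisors : ℕ → List ℕ
primeDivisors n = filter (λ p → prime? p ×-dec p ∣? n) (upTo (suc n))

-- The value at 0 is irrelevant; μ is only applied to positive integers.
μ : ℕ → ℤ
μ n = if does (all? (λ p → ¬? (p ^ 2 ∣? n)) (primeDivisors n))
      then -1ℤ ^ᶻ length (primeDivisors n)
      else 0ℤ

maxExponent : (p n bound : ℕ) → ℕ
maxExponent p n zero    = zero
maxExponent p n (suc k) = if does (p ^ suc k ∣? n) then suc k else maxExponent p n k

-- The largest k with p ^ k ∣ n.  If p > 1 and n > 0, then p ^ k ∣ n
-- forces k < p ^ k ≤ n, so searching exponents up to n suffices.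
ν : (p n : ℕ) → ℕ
ν p n = maxExponent p n n

∏[p∣_] : ℕ → (ℕ → ℤ) → ℤ
∏[p∣ n ] f = foldr _*ᶻ_ 1ℤ (map f (primeDivisors n))

Range : ∀ {n} → Vector ℕ n → Pred ℕ 0ℓ
Range x m = ∃ λ i → x i ≡ m

FactorClosed : Pred ℕ 0ℓ → Set
FactorClosed S = ∀ {m d} → m ∈ S → 0 < d → d ∣ m → d ∈ S

Matrix : ℕ → Set
Matrix n = Vector (Vector ℤ n) n

infixl 7 _⊗_
_⊗_ : ∀ {n} → Matrix n → Matrix n → Matrix n
(A ⊗ B) i j = sum λ k → A i k *ᶻ B k j

diag : ∀ {n} → Vector ℤ n → Matrix n
diag v i j = if does (i Fin.≟ j) then v i else 0ℤ

lcmMatrix : ∀ {n} → ℕ → Vector ℕ n → Matrix n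
lcmMatrix a x i j = + (lcm (x i) (x j) ^ a)

-- When x i > 0, the quotient witnessing x i ∣ x j is unique: it is x j / x i.
B : ∀ {n} → ℕ → Vector ℕ n → Matrix n
B a x i j with x i ∣? x j
... | yes xᵢ∣xⱼ = μ (quotient xᵢ∣xⱼ) *ᶻ + (quotient xᵢ∣xⱼ ^ a)
... | no  _     = 0ℤ

diagonalEntry : ℕ → ℕ → ℤ
diagonalEntry a m = ∏[p∣ m ] λ p → + (p ^ (a * ν p m)) - + (p ^ (a * (ν p m + 1)))

-- Let E be the matrix with entries (x_j / x_i) ^ a for x_i ∣ x_j and 0 otherwise, and D the claimed
-- diagonal matrix.  Both matrix identities below are sums over divisors:
--   * E B = I, because the sum of μ over the divisors of r vanishes for r > 1;
--   * [x_i , x_j] ^ a = (Eᵀ D E)_ij, because with g = gcd(x_i , x_j) this is the case n = g of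
--     n ^ a = Σ_{d ∣ n} (n / d) ^ 2a · D(d), up to the factor (x_i x_j / g²) ^ a.
-- Hence Bᵀ (Eᵀ D E) B = D.  Both divisor sums are computed by splitting off a prime power: for p ∤ n
-- the divisors of p ^ (k + 1) · n are those of p ^ k · n together with p ^ (k + 1) times those of n.
module Submission where

open import Defs
open import Data.Bool.Base using (true; false; if_then_else_)
open import Data.Fin.Base using (Fin; zero; suc)
import Data.Fin.Properties as Fin
open import Data.Integer.Base using (ℤ; +_; -_; 0ℤ; 1ℤ; -1ℤ; _-_) renaming (_+_ to _+ᶻ_; _*_ to _*ᶻ_; _^_ to _^ᶻ_)
import Data.Integer.Properties as ℤ
open import Data.Integer.Tactic.RingSolver using (solve-∀)
open import Data.List.Base as List using (List; []; _++_; filter; foldr; length; map; tabulate; upTo)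
open import Data.List.Membership.Propositional using (_∈_; _∉_)
open import Data.List.Membership.DecPropositional using (_∈?_)
open import Data.List.Membership.Propositional.Properties using (∈-++⁺ˡ; ∈-++⁺ʳ; ∈-++⁻; ∈-map⁺; ∈-map⁻; ∈-filter⁺; ∈-filter⁻; ∈-tabulate⁺; ∈-upTo⁺)
open import Data.List.Membership.Propositional.Properties.WithK using (unique∧set⇒bag)
open import Data.List.Properties using (map-cong-local; map-∘)
open import Data.List.Relation.Binary.BagAndSetEquality using (∼bag⇒↭)
open import Data.List.Relation.Binary.Permutation.Propositional using (_↭_; ↭⇒↭ₛ)
open import Data.List.Relation.Binary.Permutation.Propositional.Properties using (map⁺; ↭-length)
import Data.List.Relation.Binary.Permutation.Setoid.Properties as ↭ₛ
open import Data.List.Relation.Unary.All as All using (All; all?)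
import Data.List.Relation.Unary.AllPairs as AllPairs
open import Data.List.Relation.Unary.Any using (here; there)
open import Data.List.Relation.Unary.Unique.Propositional using (Unique)
import Data.List.Relation.Unary.Unique.Propositional.Properties as Unique
open import Data.Nat.Base using (ℕ; zero; suc; _+_; _*_; _^_; _<_; _≤_; z≤n; s≤s; NonZero; >-nonZero; nonTrivial⇒n>1)
open import Data.Nat.Coprimality using (Coprime; coprime-divisor)
open import Data.Nat.Divisibility
open import Data.Nat.GCD using (gcd; gcd[m,n]∣m; gcd[m,n]∣n; gcd-greatest)
open import Data.Nat.Induction using (<-rec)
open import Data.Nat.LCM using (lcm; gcd*lcm)
open import Data.Nat.Primality
open import Data.Nat.Primality.Factorisation using (factorise)
open import Data.Nat.Properties
open import Data.Nat.Tactic.RingSolver renaming (solve-∀ to solve-∀ℕ)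
open import Data.Product.Base using (∃; _×_; _,_; proj₂)
open import Data.Sum.Base using (_⊎_; inj₁; inj₂)
open import Data.Vec.Functional using (Vector; _∷_; transpose)
open import Function.Base using (_∘_)
open import Function.Bundles using (mk⇔)
open import Function.Definitions using (Injective)
open import Relation.Binary.PropositionalEquality
open import Relation.Nullary.Decidable using (Dec; yes; no; does; ¬?; _×-dec_; dec-true; dec-false; does-⇔)
open import Relation.Nullary.Negation using (¬_; contradiction)

open import Algebra.Properties.Semiring.Sum ℤ.+-*-semiring using (sum; sum-cong-≗; ∑-comm; *-distribˡ-sum; *-distribʳ-sum)

-- Prime powers

x*yz≡y*xz : ∀ x y z → x * (y * z) ≡ y * (x * z)
x*yz≡y*xz = solve-∀ℕ

prime∤⇒coprime : ∀ {p d} → Prime p → p ∤ d → Coprime d p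
prime∤⇒coprime pp p∤d (e∣d , e∣p) with prime⇒irreducible pp e∣p
... | inj₁ e≡1  = e≡1
... | inj₂ refl = contradiction e∣d p∤d

-- Since `d` is coprime to `p`, Gauss's lemma removes the factors `p` one at a time.
prime∤∧∣^*⇒∣ : ∀ {p d n} → Prime p → p ∤ d → ∀ k → d ∣ p ^ k * n → d ∣ n
prime∤∧∣^*⇒∣ {n = n} pp p∤d zero    d∣ = subst (_ ∣_) (*-identityˡ n) d∣
prime∤∧∣^*⇒∣ {p} {d} {n} pp p∤d (suc k) d∣ =
  prime∤∧∣^*⇒∣ pp p∤d k (coprime-divisor (prime∤⇒coprime pp p∤d) (subst (d ∣_) (*-assoc p (p ^ k) n) d∣))

prime≢⇒∤ : ∀ {p q} → Prime p → Prime q → q ≢ p → q ∤ p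
prime≢⇒∤ pp pq q≢p q∣p with prime⇒irreducible pp q∣p
... | inj₁ refl = ¬prime[1] pq
... | inj₂ q≡p  = q≢p q≡p

prime≢⇒∤^* : ∀ {p q n} → Prime p → Prime q → q ≢ p → q ∤ n → ∀ k → q ∤ p ^ k * n
prime≢⇒∤^* pp pq q≢p q∤n k = q∤n ∘ prime∤∧∣^*⇒∣ pp (prime≢⇒∤ pq pp (q≢p ∘ sym)) k

prime⇒>1 : ∀ {p} → Prime p → 1 < p
prime⇒>1 {p} pp = nonTrivial⇒n>1 p {{prime⇒nonTrivial pp}}

prime^-nonZero : ∀ {p} → Prime p → ∀ k → NonZero (p ^ k)
prime^-nonZero {p} pp k = m^n≢0 p k {{prime⇒nonZero pp}}

^suc*-assoc : ∀ p k n → p ^ suc k * n ≡ p * (p ^ k * n)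
^suc*-assoc p k n = *-assoc p (p ^ k) n

prime^suc∤ : ∀ {p n} → Prime p → p ∤ n → ∀ k → p ^ suc k ∤ p ^ k * n
prime^suc∤ {p} {n} pp p∤n k p∣ =
  p∤n (*-cancelˡ-∣ (p ^ k) {{prime^-nonZero pp k}} (subst (_∣ p ^ k * n) (*-comm p (p ^ k)) p∣))

n<m^n : ∀ {m} → 1 < m → ∀ n → n < m ^ n
n<m^n 1<m zero = s≤s z≤n
n<m^n {m} 1<m (suc n) = <-≤-trans (s≤s (n<m^n 1<m n)) (^-monoʳ-< m 1<m (n<1+n n))

-- Strong induction: as long as `p` divides `n`, pass to the smaller quotient.
splitPrimePower : ∀ {p} → Prime p → ∀ n → 0 < n → ∃ λ k → ∃ λ n′ → n ≡ p ^ k * n′ × p ∤ n′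
splitPrimePower {p} pp = <-rec _ split
  where
  split : ∀ n → (∀ {m} → m < n → 0 < m → ∃ λ k → ∃ λ n′ → m ≡ p ^ k * n′ × p ∤ n′) →
          0 < n → ∃ λ k → ∃ λ n′ → n ≡ p ^ k * n′ × p ∤ n′
  split n rec 0<n with p ∣? n
  ... | no p∤n = 0 , n , sym (*-identityˡ n) , p∤n
  ... | yes p∣n =
    let k , n′ , eq , p∤n′ = rec q<n 0<q
    in suc k , n′ , trans (m∣n⇒n≡m*quotient p∣n) (trans (cong (p *_) eq) (sym (^suc*-assoc p k n′))) , p∤n′
    where
    q<n = quotient-< p∣n {{prime⇒nonTrivial pp}} {{>-nonZero 0<n}}
    0<q = n≢0⇒n>0 λ q≡0 → <⇒≢ 0<n (sym (trans (m∣n⇒n≡quotient*m p∣n) (cong (_* p) q≡0)))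

primeDivisor : ∀ {n} → 1 < n → ∃ λ p → Prime p × p ∣ n
primeDivisor {n} 1<n with factorise n {{>-nonZero (<-trans (s≤s z≤n) 1<n)}}
... | record { factors = []     ; isFactorisation = refl } = contradiction 1<n (<-irrefl refl)
... | record { factors = p List.∷ ps ; isFactorisation = refl ; factorsPrime = pp All.∷ _ } = p , pp , m∣m*n _

-- The case distinction behind the divisor sums: the full power of one prime is split off, so the
-- cofactor is prime to `p` and multiplicativity applies.
data PrimePowerView : ℕ → Set where
  one   : PrimePowerView 1
  power : ∀ {p n} k → Prime p → 0 < n → p ∤ n → PrimePowerView (p ^ suc k * n)

primePowerView : ∀ n → 0 < n → PrimePowerView n
primePowerView n 0<n with m≤n⇒m<n∨m≡n 0<n
... | inj₂ refl = one
... | inj₁ 1<n with p , pp , p∣n ← primeDivisor 1<n with splitPrimePower pp n 0<n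
...   | zero  , n′ , refl , p∤n′ = contradiction (subst (p ∣_) (*-identityˡ n′) p∣n) p∤n′
...   | suc k , n′ , refl , p∤n′ = power k pp (n≢0⇒n>0 λ { refl → p∤n′ (p ∣0) }) p∤n′

^-monoʳ-∣ : ∀ m {i j} → i ≤ j → m ^ i ∣ m ^ j
^-monoʳ-∣ m {i} i≤j with l , refl ← m≤n⇒∃[o]m+o≡n i≤j = subst (m ^ i ∣_) (sym (^-distribˡ-+-* m i l)) (m∣m*n (m ^ l))

-- The search runs downward from `b`. An exponent above `k` is rejected, because it would make
-- `p ^ suc k` a divisor of `p ^ k * n`.
maxExponent-unique : ∀ {p n k} → Prime p → p ∤ n → ∀ b → k ≤ b → maxExponent p (p ^ k * n) b ≡ k
maxExponent-unique pp p∤n zero z≤n = refl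
maxExponent-unique {p} {n} {k} pp p∤n (suc b) k≤ with m≤n⇒m<n∨m≡n k≤
... | inj₂ refl rewrite dec-true (p ^ suc b ∣? p ^ suc b * n) (m∣m*n n) = refl
... | inj₁ (s≤s k≤b)
  rewrite dec-false (p ^ suc b ∣? p ^ k * n) (prime^suc∤ pp p∤n k ∘ ∣-trans (^-monoʳ-∣ p (s≤s k≤b)))
  = maxExponent-unique pp p∤n b k≤b

-- The search bound is the number itself, and `k < p ^ k ≤ p ^ k * n` places `k` within reach.
ν-primePower : ∀ {p n} → Prime p → 0 < n → p ∤ n → ∀ k → ν p (p ^ k * n) ≡ k
ν-primePower {p} {n} pp 0<n p∤n k =
  maxExponent-unique pp p∤n (p ^ k * n) (≤-trans (<⇒≤ (n<m^n (prime⇒>1 pp) k)) (m≤m*n (p ^ k) n {{>-nonZero 0<n}}))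

-- Splitting `n` as `q ^ l * n′` shows both valuations to be `l`, since `q` divides neither `n′` nor
-- `p ^ k * n′`.
ν-otherPrime : ∀ {p q n} → Prime p → Prime q → q ≢ p → 0 < n → ∀ k → ν q (p ^ k * n) ≡ ν q n
ν-otherPrime {p} {q} {n} pp pq q≢p 0<n k with l , n′ , refl , q∤n′ ← splitPrimePower pq n 0<n = begin
  ν q (p ^ k * (q ^ l * n′)) ≡⟨ cong (ν q) (x*yz≡y*xz (p ^ k) (q ^ l) n′) ⟩
  ν q (q ^ l * (p ^ k * n′)) ≡⟨ ν-primePower pq 0<pn′ (prime≢⇒∤^* pp pq q≢p q∤n′ k) l ⟩
  l                          ≡⟨ ν-primePower pq 0<n′ q∤n′ l ⟨
  ν q (q ^ l * n′)           ∎
  where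
  open ≡-Reasoning
  0<n′ = n≢0⇒n>0 λ { refl → q∤n′ (q ∣0) }
  0<pn′ = *-mono-≤ (m^n>0 p {{prime⇒nonZero pp}} k) 0<n′

-- Lists of prime divisors

∈-primeDivisors⁺ : ∀ {p n} → 0 < n → Prime p → p ∣ n → p ∈ primeDivisors n
∈-primeDivisors⁺ {n = n} 0<n pp p∣n = ∈-filter⁺ (λ p → prime? p ×-dec p ∣? n) (∈-upTo⁺ (s≤s (∣⇒≤ {{>-nonZero 0<n}} p∣n))) (pp , p∣n)

∈-primeDivisors⁻ : ∀ {p} n → p ∈ primeDivisors n → Prime p × p ∣ n
∈-primeDivisors⁻ n p∈ = proj₂ (∈-filter⁻ (λ p → prime? p ×-dec p ∣? n) {xs = upTo (suc n)} p∈)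

-- Reduces every reindexing of a sum or product below to a comparison of memberships.
unique∧set⇒↭ : ∀ {xs ys : List ℕ} → Unique xs → Unique ys →
  (∀ {z} → z ∈ xs → z ∈ ys) → (∀ {z} → z ∈ ys → z ∈ xs) → xs ↭ ys
unique∧set⇒↭ uxs uys to from = ∼bag⇒↭ (unique∧set⇒bag uxs uys (mk⇔ to from))

primeDivisors-unique : ∀ n → Unique (primeDivisors n)
primeDivisors-unique n = Unique.filter⁺ (λ p → prime? p ×-dec p ∣? n) (Unique.upTo⁺ (suc n))

-- A prime divisor other than `p` is coprime to the power of `p` and so divides `n`; `p ∤ n` keeps
-- the right-hand list free of duplicates.
primeDivisors-↭ : ∀ {p n} → Prime p → 0 < n → p ∤ n → ∀ k → primeDivisors (p ^ suc k * n) ↭ p List.∷ primeDivisors n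
primeDivisors-↭ {p} {n} pp 0<n p∤n k = unique∧set⇒↭ (primeDivisors-unique N)
  (All.tabulate (λ { q∈ refl → p∤n (proj₂ (∈-primeDivisors⁻ n q∈)) }) AllPairs.∷ primeDivisors-unique n)
  to from
  where
  N = p ^ suc k * n
  0<N = *-mono-≤ (m^n>0 p {{prime⇒nonZero pp}} (suc k)) 0<n
  to : ∀ {q} → q ∈ primeDivisors N → q ∈ p List.∷ primeDivisors n
  to {q} q∈ with q ≟ p | ∈-primeDivisors⁻ N q∈
  ... | yes q≡p | _ = here q≡p
  ... | no q≢p  | pq , q∣N =
    there (∈-primeDivisors⁺ 0<n pq (prime∤∧∣^*⇒∣ pp (prime≢⇒∤ pq pp (q≢p ∘ sym)) (suc k) q∣N))
  from : ∀ {q} → q ∈ p List.∷ primeDivisors n → q ∈ primeDivisors N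
  from (here refl) = ∈-primeDivisors⁺ 0<N pp (subst (p ∣_) (sym (^suc*-assoc p k n)) (m∣m*n _))
  from (there q∈) with pq , q∣n ← ∈-primeDivisors⁻ n q∈ = ∈-primeDivisors⁺ 0<N pq (∣n⇒∣m*n (p ^ suc k) q∣n)

-- Splitting a prime power off the diagonal entries and the Möbius function

localFactor : ℕ → ℕ → ℕ → ℤ
localFactor a p k = + (p ^ (a * k)) - + (p ^ (a * (k + 1)))

-- The prime `p` contributes its own factor, and the valuations at the primes of `n` are unchanged
-- by `ν-otherPrime`.
diagonalEntry-primePower : ∀ a {p n} → Prime p → 0 < n → p ∤ n → ∀ k →
  diagonalEntry a (p ^ suc k * n) ≡ localFactor a p (suc k) *ᶻ diagonalEntry a n
diagonalEntry-primePower a {p} {n} pp 0<n p∤n k = begin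
  foldr _*ᶻ_ 1ℤ (map (φ N) (primeDivisors N))
    ≡⟨ ↭ₛ.foldr-commMonoid (setoid ℤ) ℤ.*-1-isCommutativeMonoid (↭⇒↭ₛ (map⁺ (φ N) (primeDivisors-↭ pp 0<n p∤n k))) ⟩
  φ N p *ᶻ foldr _*ᶻ_ 1ℤ (map (φ N) (primeDivisors n))
    ≡⟨ cong₂ _*ᶻ_ (cong (localFactor a p) (ν-primePower pp 0<n p∤n (suc k)))
                  (cong (foldr _*ᶻ_ 1ℤ) (map-cong-local (All.tabulate φN≡φn))) ⟩
  localFactor a p (suc k) *ᶻ foldr _*ᶻ_ 1ℤ (map (φ n) (primeDivisors n)) ∎
  where
  open ≡-Reasoning
  N = p ^ suc k * n
  φ : ℕ → ℕ → ℤ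
  φ m q = localFactor a q (ν q m)
  φN≡φn : ∀ {q} → q ∈ primeDivisors n → φ N q ≡ φ n q
  φN≡φn {q} q∈ with pq , q∣n ← ∈-primeDivisors⁻ n q∈ =
    cong (localFactor a q) (ν-otherPrime pp pq (λ { refl → p∤n q∣n }) 0<n (suc k))

-- The factor `p` adds one prime divisor, which flips the sign, and occurs only once, which
-- preserves squarefreeness in both directions.
μ-p*n : ∀ {p n} → Prime p → 0 < n → p ∤ n → μ (p * n) ≡ - μ n
μ-p*n {p} {n} pp 0<n p∤n = begin
  μ (p * n)
    ≡⟨ cong₂ (λ b l → if b then -1ℤ ^ᶻ l else 0ℤ) (does-⇔ (mk⇔ to from) (squarefree? (p * n)) (squarefree? n)) (↭-length PD↭) ⟩
  (if does (squarefree? n) then -1ℤ *ᶻ -1ℤ ^ᶻ length (primeDivisors n) else 0ℤ)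
    ≡⟨ negate-if (does (squarefree? n)) ⟩
  - μ n ∎
  where
  open ≡-Reasoning
  SquareFree : ℕ → Set
  SquareFree m = All (λ q → q ^ 2 ∤ m) (primeDivisors m)
  squarefree? : ∀ m → Dec (SquareFree m)
  squarefree? m = all? (λ q → ¬? (q ^ 2 ∣? m)) (primeDivisors m)
  PD↭ : primeDivisors (p * n) ↭ p List.∷ primeDivisors n
  PD↭ = subst (λ m → primeDivisors (m * n) ↭ p List.∷ primeDivisors n) (*-identityʳ p) (primeDivisors-↭ pp 0<n p∤n 0)
  0<pn = *-mono-≤ (≤-trans (s≤s z≤n) (prime⇒>1 pp)) 0<n
  to : SquareFree (p * n) → SquareFree n
  to sf = All.tabulate λ q∈ q²∣n → let pq , q∣n = ∈-primeDivisors⁻ n q∈ in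
    All.lookup sf (∈-primeDivisors⁺ 0<pn pq (∣n⇒∣m*n p q∣n)) (∣n⇒∣m*n p q²∣n)
  from : SquareFree n → SquareFree (p * n)
  from sf = All.tabulate noSquare
    where
    noSquare : ∀ {q} → q ∈ primeDivisors (p * n) → q ^ 2 ∤ p * n
    noSquare {q} q∈ q²∣ with q ≟ p | ∈-primeDivisors⁻ (p * n) q∈
    ... | yes refl | _ = p∤n (*-cancelˡ-∣ p {{prime⇒nonZero pp}} (subst (_∣ p * n) (cong (p *_) (*-identityʳ p)) q²∣))
    ... | no q≢p | pq , q∣ = All.lookup sf (∈-primeDivisors⁺ 0<n pq (reduce (λ p∣q → prime≢⇒∤ pq pp (q≢p ∘ sym) p∣q) q∣))
                               (reduce p∤q² q²∣)
      where
      -- For `q ≢ p` this strips `p` from both `q ∣ p * n` and `q ^ 2 ∣ p * n`; `p * n` is read as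
      -- `p ^ 1 * n`.
      reduce : ∀ {d} → p ∤ d → d ∣ p * n → d ∣ n
      reduce p∤d = prime∤∧∣^*⇒∣ pp p∤d 1 ∘ subst (λ m → _ ∣ m * n) (sym (*-identityʳ p))
      p∤q² : p ∤ q ^ 2
      p∤q² p∣ with euclidsLemma q (q * 1) pp p∣
      ... | inj₁ p∣q = prime≢⇒∤ pq pp (q≢p ∘ sym) p∣q
      ... | inj₂ p∣q = prime≢⇒∤ pq pp (q≢p ∘ sym) (subst (p ∣_) (*-identityʳ q) p∣q)
  negate-if : ∀ b → (if b then -1ℤ *ᶻ -1ℤ ^ᶻ length (primeDivisors n) else 0ℤ) ≡ - (if b then -1ℤ ^ᶻ length (primeDivisors n) else 0ℤ)
  negate-if true  = ℤ.-1*i≡-i _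
  negate-if false = refl

μ-square : ∀ {p n} → Prime p → 0 < n → p ^ 2 ∣ n → μ n ≡ 0ℤ
μ-square {p} {n} pp 0<n p²∣n
  rewrite dec-false (all? (λ q → ¬? (q ^ 2 ∣? n)) (primeDivisors n))
    (λ sf → All.lookup sf (∈-primeDivisors⁺ 0<n pp (∣-trans (m∣m*n (p * 1)) p²∣n)) p²∣n) = refl

-- Sums over divisors

Σ[_] : List ℕ → (ℕ → ℤ) → ℤ
Σ[ L ] f = foldr _+ᶻ_ 0ℤ (map f L)

Σ-↭ : ∀ {L M} f → L ↭ M → Σ[ L ] f ≡ Σ[ M ] f
Σ-↭ f L↭M = ↭ₛ.foldr-commMonoid (setoid ℤ) ℤ.+-0-isCommutativeMonoid (↭⇒↭ₛ (map⁺ f L↭M))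

Σ-cong : ∀ {L f g} → (∀ {d} → d ∈ L → f d ≡ g d) → Σ[ L ] f ≡ Σ[ L ] g
Σ-cong f≡g = cong (foldr _+ᶻ_ 0ℤ) (map-cong-local (All.tabulate f≡g))

Σ-++ : ∀ L M f → Σ[ L ++ M ] f ≡ Σ[ L ] f +ᶻ Σ[ M ] f
Σ-++ List.[]      M f = sym (ℤ.+-identityˡ _)
Σ-++ (d List.∷ L) M f = trans (cong (f d +ᶻ_) (Σ-++ L M f)) (sym (ℤ.+-assoc (f d) _ _))

Σ-map : ∀ g L f → Σ[ map g L ] f ≡ Σ[ L ] (f ∘ g)
Σ-map g L f = cong (foldr _+ᶻ_ 0ℤ) (sym (map-∘ L))

Σ-*ˡ : ∀ z L f → Σ[ L ] (λ d → z *ᶻ f d) ≡ z *ᶻ Σ[ L ] f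
Σ-*ˡ z List.[]      f = sym (ℤ.*-zeroʳ z)
Σ-*ˡ z (d List.∷ L) f = trans (cong (z *ᶻ f d +ᶻ_) (Σ-*ˡ z L f)) (sym (ℤ.*-distribˡ-+ z (f d) _))

Σ-zero : ∀ {L f} → (∀ {d} → d ∈ L → f d ≡ 0ℤ) → Σ[ L ] f ≡ 0ℤ
-- The zero summand is read as `0ℤ *ᶻ 0ℤ`, so that a scalar `0ℤ` can be pulled out.
Σ-zero {L} f≡0 = trans (Σ-cong f≡0) (Σ-*ˡ 0ℤ L (λ _ → 0ℤ))

divisors : ℕ → List ℕ
divisors n = filter (_∣? n) (upTo (suc n))

divisors-unique : ∀ n → Unique (divisors n)
divisors-unique n = Unique.filter⁺ (_∣? n) (Unique.upTo⁺ (suc n))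

∈-divisors⁺ : ∀ {d n} → 0 < n → d ∣ n → d ∈ divisors n
∈-divisors⁺ {n = n} 0<n d∣n = ∈-filter⁺ (_∣? n) (∈-upTo⁺ (s≤s (∣⇒≤ {{>-nonZero 0<n}} d∣n))) d∣n

∈-divisors⁻ : ∀ {d} n → d ∈ divisors n → d ∣ n
∈-divisors⁻ n d∈ = proj₂ (∈-filter⁻ (_∣? n) {xs = upTo (suc n)} d∈)

∣⇒0< : ∀ {d n} → 0 < n → d ∣ n → 0 < d
∣⇒0< 0<n d∣n = n≢0⇒n>0 λ { refl → <⇒≢ 0<n (sym (0∣⇒≡0 d∣n)) }

0<^* : ∀ {p n} → Prime p → 0 < n → ∀ k → 0 < p ^ k * n
0<^* {p} pp 0<n k = *-mono-≤ (m^n>0 p {{prime⇒nonZero pp}} k) 0<n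

-- A divisor that does not divide `p ^ k * n` carries the full power `p ^ suc k`, and its cofactor
-- divides `n`. The two lists are disjoint because `p ^ suc k` does not divide `p ^ k * n`.
divisors-↭ : ∀ {p n} → Prime p → 0 < n → p ∤ n → ∀ k →
  divisors (p ^ suc k * n) ↭ divisors (p ^ k * n) ++ map (p ^ suc k *_) (divisors n)
divisors-↭ {p} {n} pp 0<n p∤n k = unique∧set⇒↭ (divisors-unique (p ^ suc k * n))
  (Unique.++⁺ (divisors-unique (p ^ k * n))
              (Unique.map⁺ (*-cancelˡ-≡ _ _ (p ^ suc k) {{prime^-nonZero pp (suc k)}}) (divisors-unique n))
              disjoint)
  to from
  where
  disjoint : ∀ {d} → ¬ (d ∈ divisors (p ^ k * n) × d ∈ map (p ^ suc k *_) (divisors n))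
  disjoint (d∈₁ , d∈₂) with c , _ , refl ← ∈-map⁻ (p ^ suc k *_) d∈₂ =
    prime^suc∤ pp p∤n k (m*n∣⇒m∣ (p ^ suc k) c (∈-divisors⁻ (p ^ k * n) d∈₁))
  -- If `p ∤ d`, then already `d ∣ n`. Otherwise one `p` is cancelled on both sides and the exponent
  -- drops; when it is used up, what remains of `d` divides `n`.
  split : ∀ {d} k → d ∣ p ^ suc k * n → d ∣ p ^ k * n ⊎ ∃ λ c → c ∣ n × d ≡ p ^ suc k * c
  split {d} k d∣ with p ∣? d
  ... | no p∤d = inj₁ (∣n⇒∣m*n (p ^ k) (prime∤∧∣^*⇒∣ pp p∤d (suc k) d∣))
  ... | yes (divides e refl) = split′ k (*-cancelˡ-∣ p {{prime⇒nonZero pp}} (subst₂ _∣_ (*-comm e p) (^suc*-assoc p k n) d∣))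
    where
    split′ : ∀ k → e ∣ p ^ k * n → e * p ∣ p ^ k * n ⊎ ∃ λ c → c ∣ n × e * p ≡ p ^ suc k * c
    split′ zero e∣ = inj₂ (e , subst (e ∣_) (*-identityˡ n) e∣ , trans (*-comm e p) (cong (_* e) (sym (*-identityʳ p))))
    split′ (suc k) e∣ with split k e∣
    ... | inj₁ e∣′ = inj₁ (subst₂ _∣_ (*-comm p e) (sym (^suc*-assoc p k n)) (*-monoʳ-∣ p e∣′))
    ... | inj₂ (c , c∣n , refl) = inj₂ (c , c∣n , trans (*-comm _ p) (sym (^suc*-assoc p (suc k) c)))
  to : ∀ {d} → d ∈ divisors (p ^ suc k * n) → d ∈ divisors (p ^ k * n) ++ map (p ^ suc k *_) (divisors n)
  to d∈ with split k (∈-divisors⁻ (p ^ suc k * n) d∈)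
  ... | inj₁ d∣ = ∈-++⁺ˡ (∈-divisors⁺ (0<^* pp 0<n k) d∣)
  ... | inj₂ (c , c∣n , refl) = ∈-++⁺ʳ (divisors (p ^ k * n)) (∈-map⁺ (p ^ suc k *_) (∈-divisors⁺ 0<n c∣n))
  from : ∀ {d} → d ∈ divisors (p ^ k * n) ++ map (p ^ suc k *_) (divisors n) → d ∈ divisors (p ^ suc k * n)
  from {d} d∈ with ∈-++⁻ (divisors (p ^ k * n)) d∈
  ... | inj₁ d∈₁ = ∈-divisors⁺ (0<^* pp 0<n (suc k))
    (subst (d ∣_) (sym (^suc*-assoc p k n)) (∣n⇒∣m*n p (∈-divisors⁻ (p ^ k * n) d∈₁)))
  ... | inj₂ d∈₂ with c , c∈ , refl ← ∈-map⁻ (p ^ suc k *_) d∈₂ =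
    ∈-divisors⁺ (0<^* pp 0<n (suc k)) (*-monoʳ-∣ (p ^ suc k) (∈-divisors⁻ n c∈))

Σ-divisors-primePower : ∀ {p n} → Prime p → 0 < n → p ∤ n → ∀ k f →
  Σ[ divisors (p ^ suc k * n) ] f ≡ Σ[ divisors (p ^ k * n) ] f +ᶻ Σ[ divisors n ] (f ∘ (p ^ suc k *_))
Σ-divisors-primePower {p} {n} pp 0<n p∤n k f =
  trans (Σ-↭ f (divisors-↭ pp 0<n p∤n k))
    (trans (Σ-++ (divisors (p ^ k * n)) _ f)
      (cong (Σ[ divisors (p ^ k * n) ] f +ᶻ_) (Σ-map (p ^ suc k *_) (divisors n) f)))

-- The element of the incidence algebra of divisibility with value f (n / d) at the interval [d , n].
onQuotient : (ℕ → ℤ) → ℕ → ℕ → ℤ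
onQuotient f d n with d ∣? n
... | yes d∣n = f (quotient d∣n)
... | no  _   = 0ℤ

onQuotient-≡ : ∀ f {d n} q → 0 < d → n ≡ q * d → onQuotient f d n ≡ f q
onQuotient-≡ f {d} {n} q 0<d refl with d ∣? q * d
... | yes (divides q′ eq) = cong f (*-cancelʳ-≡ q′ q d {{>-nonZero 0<d}} (sym eq))
... | no d∤n = contradiction (n∣m*n q) d∤n

onQuotient-∤ : ∀ f {d n} → d ∤ n → onQuotient f d n ≡ 0ℤ
onQuotient-∤ f {d} {n} d∤n with d ∣? n
... | yes d∣n = contradiction d∣n d∤n
... | no  _   = refl

-- Both intervals have the same cofactor `q`.
onQuotient-cancelˡ : ∀ f c {d n} → 0 < c → 0 < n → d ∣ n → onQuotient f (c * d) (c * n) ≡ onQuotient f d n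
onQuotient-cancelˡ f c {d} 0<c 0<n (divides q refl) =
  trans (onQuotient-≡ f q (*-mono-≤ 0<c 0<d) (x*yz≡y*xz c q d)) (sym (onQuotient-≡ f q 0<d refl))
  where
  0<d = ∣⇒0< 0<n (n∣m*n q)

-- The quotient `q` divides `n`, hence is prime to `p`, and `μ-p*n` applies to `p * q`.
onQuotient-μ-p* : ∀ {p n d} → Prime p → 0 < n → p ∤ n → d ∣ n → onQuotient μ d (p * n) ≡ -1ℤ *ᶻ onQuotient μ d n
onQuotient-μ-p* {p} {_} {d} pp 0<n p∤n (divides q refl) = begin
  onQuotient μ d (p * (q * d))  ≡⟨ onQuotient-≡ μ (p * q) 0<d (sym (*-assoc p q d)) ⟩
  μ (p * q)                     ≡⟨ μ-p*n pp (∣⇒0< 0<n (m∣m*n d)) (p∤n ∘ ∣m⇒∣m*n d) ⟩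
  - μ q                         ≡⟨ ℤ.-1*i≡-i (μ q) ⟨
  -1ℤ *ᶻ μ q                    ≡⟨ cong (-1ℤ *ᶻ_) (onQuotient-≡ μ q 0<d refl) ⟨
  -1ℤ *ᶻ onQuotient μ d (q * d) ∎
  where
  open ≡-Reasoning
  0<d = ∣⇒0< 0<n (n∣m*n q)

onQuotient-μ-p²* : ∀ {p n d} → Prime p → 0 < n → d ∣ n → onQuotient μ d (p * (p * n)) ≡ 0ℤ
onQuotient-μ-p²* {p} {_} {d} pp 0<n (divides q refl) =
  trans (onQuotient-≡ μ (p * (p * q)) (∣⇒0< 0<n (n∣m*n q)) (assoc² p q d))
        (μ-square pp (subst (0 <_) p²q≡ (0<^* pp (∣⇒0< 0<n (m∣m*n d)) 2)) (subst (p ^ 2 ∣_) p²q≡ (m∣m*n q)))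
  where
  assoc² : ∀ x y z → x * (x * (y * z)) ≡ x * (x * y) * z
  assoc² = solve-∀ℕ
  p²q≡ : p ^ 2 * q ≡ p * (p * q)
  p²q≡ = trans (*-assoc p (p * 1) q) (cong (λ r → p * (r * q)) (*-identityʳ p))

-- Vanishing of the divisor sum of the Möbius function

Σμ : ℕ → ℤ
Σμ n = Σ[ divisors n ] λ d → onQuotient μ d n

-- A divisor d of p ^ k * n either divides p ^ (k - 1) * n, and then p² divides the quotient, or is p ^ k * c with c ∣ n.
Σμ-primePower⁻ : ∀ {p n} → Prime p → 0 < n → p ∤ n → ∀ k →
  Σ[ divisors (p ^ k * n) ] (λ d → onQuotient μ d (p ^ suc k * n)) ≡ -1ℤ *ᶻ Σμ n
Σμ-primePower⁻ {p} {n} pp 0<n p∤n zero rewrite *-identityˡ n | *-identityʳ p =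
  trans (Σ-cong λ d∈ → onQuotient-μ-p* pp 0<n p∤n (∈-divisors⁻ n d∈)) (Σ-*ˡ -1ℤ (divisors n) _)
Σμ-primePower⁻ {p} {n} pp 0<n p∤n (suc k) = begin
  Σ[ divisors (p ^ suc k * n) ] f
    ≡⟨ Σ-divisors-primePower pp 0<n p∤n k f ⟩
  Σ[ divisors (p ^ k * n) ] f +ᶻ Σ[ divisors n ] (f ∘ (p ^ suc k *_))
    ≡⟨ cong₂ _+ᶻ_ (Σ-zero λ d∈ → first (∈-divisors⁻ _ d∈)) (Σ-cong λ d∈ → second (∈-divisors⁻ n d∈)) ⟩
  0ℤ +ᶻ Σ[ divisors n ] (λ d → -1ℤ *ᶻ onQuotient μ d n)
    ≡⟨ trans (ℤ.+-identityˡ _) (Σ-*ˡ -1ℤ (divisors n) _) ⟩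
  -1ℤ *ᶻ Σμ n ∎
  where
  open ≡-Reasoning
  f : ℕ → ℤ
  f d = onQuotient μ d (p ^ suc (suc k) * n)
  first : ∀ {d} → d ∣ p ^ k * n → f d ≡ 0ℤ
  first {d} d∣ = trans (cong (onQuotient μ d) (trans (^suc*-assoc p (suc k) n) (cong (p *_) (^suc*-assoc p k n))))
                   (onQuotient-μ-p²* pp (0<^* pp 0<n k) d∣)
  second : ∀ {d} → d ∣ n → f (p ^ suc k * d) ≡ -1ℤ *ᶻ onQuotient μ d n
  second {d} d∣ = begin
    onQuotient μ (p ^ suc k * d) (p * p ^ suc k * n)
      ≡⟨ cong (onQuotient μ (p ^ suc k * d)) (trans (cong (_* n) (*-comm p (p ^ suc k))) (*-assoc (p ^ suc k) p n)) ⟩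
    onQuotient μ (p ^ suc k * d) (p ^ suc k * (p * n))
      ≡⟨ onQuotient-cancelˡ μ (p ^ suc k) (m^n>0 p {{prime⇒nonZero pp}} (suc k)) (*-mono-≤ (<⇒≤ (prime⇒>1 pp)) 0<n) (∣n⇒∣m*n p d∣) ⟩
    onQuotient μ d (p * n)
      ≡⟨ onQuotient-μ-p* pp 0<n p∤n d∣ ⟩
    -1ℤ *ᶻ onQuotient μ d n ∎

-- For `p ^ suc k * n′`, the divisors of `p ^ k * n′` contribute the negative of `Σμ n′`, and those
-- containing `p ^ suc k` contribute `Σμ n′`. The two cancel, whatever the value of `Σμ n′`.
Σμ≡0 : ∀ {n} → 1 < n → Σμ n ≡ 0ℤ
Σμ≡0 {n} 1<n with primePowerView n (<⇒≤ 1<n)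
... | one = contradiction 1<n (<-irrefl refl)
... | power {p} {n′} k pp 0<n′ p∤n′ = begin
  Σμ N
    ≡⟨ Σ-divisors-primePower pp 0<n′ p∤n′ k (λ d → onQuotient μ d N) ⟩
  Σ[ divisors (p ^ k * n′) ] (λ d → onQuotient μ d N) +ᶻ Σ[ divisors n′ ] (λ d → onQuotient μ (p ^ suc k * d) N)
    ≡⟨ cong₂ _+ᶻ_ (Σμ-primePower⁻ pp 0<n′ p∤n′ k)
         (Σ-cong λ d∈ → onQuotient-cancelˡ μ (p ^ suc k) (m^n>0 p {{prime⇒nonZero pp}} (suc k)) 0<n′ (∈-divisors⁻ n′ d∈)) ⟩
  -1ℤ *ᶻ Σμ n′ +ᶻ Σμ n′
    ≡⟨ -x+x≡0 (Σμ n′) ⟩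
  0ℤ ∎
  where
  open ≡-Reasoning
  N = p ^ suc k * n′
  -x+x≡0 : ∀ x → -1ℤ *ᶻ x +ᶻ x ≡ 0ℤ
  -x+x≡0 x = trans (cong (_+ᶻ x) (ℤ.-1*i≡-i x)) (ℤ.+-inverseˡ x)

-- Powers as divisor sums of the diagonal entries

^-distribʳ-* : ∀ a m n → (m * n) ^ a ≡ m ^ a * n ^ a
^-distribʳ-* zero    m n = refl
^-distribʳ-* (suc a) m n = trans (cong (m * n *_) (^-distribʳ-* a m n)) (interchangeℕ m n (m ^ a) (n ^ a))
  where
  interchangeℕ : ∀ w x y z → (w * x) * (y * z) ≡ (w * y) * (x * z)
  interchangeℕ = solve-∀ℕ

pow : ℕ → ℕ → ℤ
pow a n = + (n ^ a)

pow-* : ∀ a m n → pow a (m * n) ≡ pow a m *ᶻ pow a n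
pow-* a m n = trans (cong +_ (^-distribʳ-* a m n)) (ℤ.pos-* (m ^ a) (n ^ a))

-- The exponent `2a` is kept as a product, so that in `lcm≡Σ` one factor can go to each of the two
-- arguments.
pow² : ℕ → ℕ → ℤ
pow² a n = pow a n *ᶻ pow a n

interchange : ∀ w x y z → (w *ᶻ x) *ᶻ (y *ᶻ z) ≡ (w *ᶻ y) *ᶻ (x *ᶻ z)
interchange = solve-∀

pow²-* : ∀ a m n → pow² a (m * n) ≡ pow² a m *ᶻ pow² a n
pow²-* a m n = trans (cong₂ _*ᶻ_ (pow-* a m n) (pow-* a m n)) (interchange (pow a m) (pow a n) (pow a m) (pow a n))

-- Brings the local factor into the polynomial form that `telescope` needs.
localFactor-suc : ∀ a p k → localFactor a p (suc k) ≡ pow a p *ᶻ pow a (p ^ k) - pow a p *ᶻ (pow a p *ᶻ pow a (p ^ k))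
localFactor-suc a p k = cong₂ _-_ (step k)
  (trans (cong (λ l → + (p ^ (a * l))) (+-comm (suc k) 1)) (trans (step (suc k)) (cong (pow a p *ᶻ_) (pow-* a p (p ^ k)))))
  where
  step : ∀ k → + (p ^ (a * suc k)) ≡ pow a p *ᶻ pow a (p ^ k)
  step k = trans (cong +_ (trans (cong (p ^_) (*-comm a (suc k))) (sym (^-*-assoc p (suc k) a)))) (pow-* a p (p ^ k))

-- The Dirichlet convolution of `pow² a` with `diagonalEntry a`.
convolution : ℕ → ℕ → ℤ
convolution a n = Σ[ divisors n ] λ d → onQuotient (pow² a) d n *ᶻ diagonalEntry a d

-- Induction on `k`. For divisors of `p ^ k * n` the quotient gains a factor `p`, so they give
-- `pow² a p` times the previous convolution; the others give the local factor times the convolution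
-- at `n`. The negative term of the local factor cancels the first contribution.
convolution-primePower : ∀ a {p n} → Prime p → 0 < n → p ∤ n → convolution a n ≡ pow a n →
  ∀ k → convolution a (p ^ k * n) ≡ pow a (p ^ k * n)
convolution-primePower a {p} {n} pp 0<n p∤n hyp zero rewrite *-identityˡ n = hyp
convolution-primePower a {p} {n} pp 0<n p∤n hyp (suc k) = begin
  convolution a (p ^ suc k * n)
    ≡⟨ Σ-divisors-primePower pp 0<n p∤n k _ ⟩
  Σ[ divisors (p ^ k * n) ] (λ d → onQuotient (pow² a) d (p ^ suc k * n) *ᶻ diagonalEntry a d) +ᶻ
  Σ[ divisors n ] (λ d → onQuotient (pow² a) (p ^ suc k * d) (p ^ suc k * n) *ᶻ diagonalEntry a (p ^ suc k * d))
    ≡⟨ cong₂ _+ᶻ_ (trans (Σ-cong λ d∈ → first (∈-divisors⁻ _ d∈)) (Σ-*ˡ (pow² a p) (divisors (p ^ k * n)) _))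
                  (trans (Σ-cong λ d∈ → second (∈-divisors⁻ n d∈)) (Σ-*ˡ φ (divisors n) _)) ⟩
  pow² a p *ᶻ convolution a (p ^ k * n) +ᶻ φ *ᶻ convolution a n
    ≡⟨ cong₂ (λ x y → pow² a p *ᶻ x +ᶻ φ *ᶻ y) (trans (convolution-primePower a pp 0<n p∤n hyp k) (pow-* a (p ^ k) n)) hyp ⟩
  pow² a p *ᶻ (pow a (p ^ k) *ᶻ pow a n) +ᶻ φ *ᶻ pow a n
    ≡⟨ cong (λ x → pow² a p *ᶻ (pow a (p ^ k) *ᶻ pow a n) +ᶻ x *ᶻ pow a n) (localFactor-suc a p k) ⟩
  pow² a p *ᶻ (pow a (p ^ k) *ᶻ pow a n) +ᶻ (pow a p *ᶻ pow a (p ^ k) - pow a p *ᶻ (pow a p *ᶻ pow a (p ^ k))) *ᶻ pow a n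
    ≡⟨ telescope (pow a p) (pow a (p ^ k)) (pow a n) ⟩
  pow a p *ᶻ pow a (p ^ k) *ᶻ pow a n
    ≡⟨ trans (pow-* a (p ^ suc k) n) (cong (_*ᶻ pow a n) (pow-* a p (p ^ k))) ⟨
  pow a (p ^ suc k * n) ∎
  where
  open ≡-Reasoning
  φ = localFactor a p (suc k)
  telescope : ∀ x y z → (x *ᶻ x) *ᶻ (y *ᶻ z) +ᶻ (x *ᶻ y - x *ᶻ (x *ᶻ y)) *ᶻ z ≡ x *ᶻ y *ᶻ z
  telescope = solve-∀
  first : ∀ {d} → d ∣ p ^ k * n → onQuotient (pow² a) d (p ^ suc k * n) *ᶻ diagonalEntry a d ≡
                                  pow² a p *ᶻ (onQuotient (pow² a) d (p ^ k * n) *ᶻ diagonalEntry a d)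
  first {d} d∣@(divides q eq) = trans (cong (_*ᶻ diagonalEntry a d) (begin
    onQuotient (pow² a) d (p ^ suc k * n)
      ≡⟨ onQuotient-≡ (pow² a) (p * q) 0<d (trans (^suc*-assoc p k n) (trans (cong (p *_) eq) (sym (*-assoc p q d)))) ⟩
    pow² a (p * q)                           ≡⟨ pow²-* a p q ⟩
    pow² a p *ᶻ pow² a q                     ≡⟨ cong (pow² a p *ᶻ_) (onQuotient-≡ (pow² a) q 0<d eq) ⟨
    pow² a p *ᶻ onQuotient (pow² a) d (p ^ k * n) ∎))
    (ℤ.*-assoc (pow² a p) _ _)
    where 0<d = ∣⇒0< (0<^* pp 0<n k) d∣
  second : ∀ {d} → d ∣ n → onQuotient (pow² a) (p ^ suc k * d) (p ^ suc k * n) *ᶻ diagonalEntry a (p ^ suc k * d) ≡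
                           φ *ᶻ (onQuotient (pow² a) d n *ᶻ diagonalEntry a d)
  second {d} d∣ = trans
    (cong₂ _*ᶻ_ (onQuotient-cancelˡ (pow² a) (p ^ suc k) (m^n>0 p {{prime⇒nonZero pp}} (suc k)) 0<n d∣)
                (diagonalEntry-primePower a pp (∣⇒0< 0<n d∣) (p∤n ∘ λ p∣d → ∣-trans p∣d d∣) k))
    (swap (onQuotient (pow² a) d n) φ (diagonalEntry a d))
    where
    swap : ∀ x y z → x *ᶻ (y *ᶻ z) ≡ y *ᶻ (x *ᶻ z)
    swap = solve-∀

-- Strong induction, removing the whole power of one prime at each step.
convolution≡pow : ∀ a n → 0 < n → convolution a n ≡ pow a n
convolution≡pow a = <-rec _ go
  where
  go : ∀ n → (∀ {m} → m < n → 0 < m → convolution a m ≡ pow a m) → 0 < n → convolution a n ≡ pow a n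
  go n rec 0<n with primePowerView n 0<n
  ... | one rewrite ^-zeroˡ a = refl
  ... | power {p} {n′} k pp 0<n′ p∤n′ = convolution-primePower a pp 0<n′ p∤n′ (rec n′<n 0<n′) (suc k)
    where
    n′<n : n′ < p ^ suc k * n′
    n′<n = subst (n′ <_) (*-comm n′ (p ^ suc k)) (m<m*n n′ (p ^ suc k) {{>-nonZero 0<n′}} (≤-trans (prime⇒>1 pp) (m≤m*n p (p ^ k) {{prime^-nonZero pp k}})))

-- With `m = m′ * g` and `n = n′ * g` the lcm is `m′ * n′ * g`, and `pow a g` is expanded as a
-- convolution. For `g = q * d`, one factor `pow a q` joins `m′` to form the quotient of `m` by `d`,
-- the other joins `n′`.
lcm≡Σ : ∀ a {m n} → 0 < m → 0 < n →
  pow a (lcm m n) ≡ Σ[ divisors (gcd m n) ] λ d → onQuotient (pow a) d m *ᶻ (diagonalEntry a d *ᶻ onQuotient (pow a) d n)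
lcm≡Σ a {m} {n} 0<m 0<n = begin
  pow a (lcm m n)                                 ≡⟨ cong (pow a) lcm≡ ⟩
  pow a (m′ * n′ * g)                             ≡⟨ trans (pow-* a (m′ * n′) g) (cong (_*ᶻ pow a g) (pow-* a m′ n′)) ⟩
  (pow a m′ *ᶻ pow a n′) *ᶻ pow a g               ≡⟨ cong ((pow a m′ *ᶻ pow a n′) *ᶻ_) (convolution≡pow a g 0<g) ⟨
  (pow a m′ *ᶻ pow a n′) *ᶻ convolution a g       ≡⟨ Σ-*ˡ (pow a m′ *ᶻ pow a n′) (divisors g) _ ⟨
  Σ[ divisors g ] (λ d → (pow a m′ *ᶻ pow a n′) *ᶻ (onQuotient (pow² a) d g *ᶻ diagonalEntry a d))
                                                  ≡⟨ Σ-cong (λ d∈ → summand (∈-divisors⁻ g d∈)) ⟩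
  Σ[ divisors g ] (λ d → onQuotient (pow a) d m *ᶻ (diagonalEntry a d *ᶻ onQuotient (pow a) d n)) ∎
  where
  open ≡-Reasoning
  g = gcd m n
  0<g = ∣⇒0< 0<m (gcd[m,n]∣m m n)
  m′ = quotient (gcd[m,n]∣m m n)
  n′ = quotient (gcd[m,n]∣n m n)
  m≡ : m ≡ m′ * g
  m≡ = m∣n⇒n≡quotient*m (gcd[m,n]∣m m n)
  n≡ : n ≡ n′ * g
  n≡ = m∣n⇒n≡quotient*m (gcd[m,n]∣n m n)
  regroup : ∀ x y z → (x * z) * (y * z) ≡ z * (x * y * z)
  regroup = solve-∀ℕ
  lcm≡ : lcm m n ≡ m′ * n′ * g
  lcm≡ = *-cancelˡ-≡ _ _ g {{>-nonZero 0<g}} (trans (gcd*lcm m n) (trans (cong₂ _*_ m≡ n≡) (regroup m′ n′ g)))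
  summand : ∀ {d} → d ∣ g → (pow a m′ *ᶻ pow a n′) *ᶻ (onQuotient (pow² a) d g *ᶻ diagonalEntry a d) ≡
                            onQuotient (pow a) d m *ᶻ (diagonalEntry a d *ᶻ onQuotient (pow a) d n)
  summand {d} d∣g@(divides q eq) = begin
    (pow a m′ *ᶻ pow a n′) *ᶻ (onQuotient (pow² a) d g *ᶻ δ)
      ≡⟨ cong (λ z → (pow a m′ *ᶻ pow a n′) *ᶻ (z *ᶻ δ)) (onQuotient-≡ (pow² a) q 0<d eq) ⟩
    (pow a m′ *ᶻ pow a n′) *ᶻ ((pow a q *ᶻ pow a q) *ᶻ δ)
      ≡⟨ redistribute (pow a m′) (pow a n′) (pow a q) δ ⟩
    (pow a m′ *ᶻ pow a q) *ᶻ (δ *ᶻ (pow a n′ *ᶻ pow a q))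
      ≡⟨ cong₂ (λ x y → x *ᶻ (δ *ᶻ y)) (onQuotient-pow m≡) (onQuotient-pow n≡) ⟨
    onQuotient (pow a) d m *ᶻ (δ *ᶻ onQuotient (pow a) d n) ∎
    where
    δ = diagonalEntry a d
    0<d = ∣⇒0< 0<g d∣g
    redistribute : ∀ x y z w → (x *ᶻ y) *ᶻ ((z *ᶻ z) *ᶻ w) ≡ (x *ᶻ z) *ᶻ (w *ᶻ (y *ᶻ z))
    redistribute = solve-∀
    onQuotient-pow : ∀ {l l′} → l ≡ l′ * g → onQuotient (pow a) d l ≡ pow a l′ *ᶻ pow a q
    onQuotient-pow {l} {l′} l≡ = trans
      (onQuotient-≡ (pow a) (l′ * q) 0<d (trans l≡ (trans (cong (l′ *_) eq) (sym (*-assoc l′ q d)))))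
      (pow-* a l′ q)

-- Matrices indexed by a factor closed set

sum-tabulate : ∀ {n} (x : Vector ℕ n) f → sum (f ∘ x) ≡ Σ[ tabulate x ] f
sum-tabulate {zero}  x f = refl
sum-tabulate {suc n} x f = cong (f (x zero) +ᶻ_) (sum-tabulate (x ∘ suc) f)

Σ-filter : ∀ {P : ℕ → Set} (P? : ∀ d → Dec (P d)) {f} → (∀ {d} → ¬ P d → f d ≡ 0ℤ) →
  ∀ L → Σ[ filter P? L ] f ≡ Σ[ L ] f
Σ-filter P? f≡0 List.[] = refl
Σ-filter P? {f} f≡0 (d List.∷ L) with P? d
... | yes _ = cong (f d +ᶻ_) (Σ-filter P? f≡0 L)
... | no ¬p = trans (Σ-filter P? f≡0 L) (sym (trans (cong (_+ᶻ Σ[ L ] f) (f≡0 ¬p)) (ℤ.+-identityˡ _)))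

-- The passage from sums over matrix indices to sums over divisors: by injectivity, the values of
-- `x` that lie in `L` form a duplicate-free list with the same elements as `L`.
sum-support : ∀ {n} {x : Vector ℕ n} → Injective _≡_ _≡_ x → ∀ {L} → Unique L → (∀ {d} → d ∈ L → Range x d) →
  ∀ {f} → (∀ {d} → d ∉ L → f d ≡ 0ℤ) → sum (f ∘ x) ≡ Σ[ L ] f
sum-support {x = x} x-inj {L} L! L⊆x {f} f≡0 = begin
  sum (f ∘ x)                           ≡⟨ sum-tabulate x f ⟩
  Σ[ tabulate x ] f                     ≡⟨ Σ-filter (λ d → d ∈ℕ? L) f≡0 (tabulate x) ⟨
  Σ[ filter (_∈ℕ? L) (tabulate x) ] f   ≡⟨ Σ-↭ f (unique∧set⇒↭ (Unique.filter⁺ (_∈ℕ? L) (Unique.tabulate⁺ x-inj)) L!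
                                             (λ d∈ → proj₂ (∈-filter⁻ (_∈ℕ? L) {xs = tabulate x} d∈)) from) ⟩
  Σ[ L ] f                              ∎
  where
  open ≡-Reasoning
  _∈ℕ?_ = _∈?_ _≟_
  from : ∀ {d} → d ∈ L → d ∈ filter (_∈ℕ? L) (tabulate x)
  from d∈L with i , refl ← L⊆x d∈L = ∈-filter⁺ (_∈ℕ? L) (∈-tabulate⁺ i) d∈L

identity : ∀ {n} → Matrix n
identity = diag (λ _ → 1ℤ)

sum-identity : ∀ {n} (i : Fin n) (f : Vector ℤ n) → sum (λ c → identity c i *ᶻ f c) ≡ f i
sum-identity {suc n} zero f = begin
  1ℤ *ᶻ f zero +ᶻ sum (λ c → 0ℤ *ᶻ f (suc c)) ≡⟨ cong₂ _+ᶻ_ (ℤ.*-identityˡ (f zero)) (sym (*-distribˡ-sum 0ℤ (f ∘ suc))) ⟩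
  f zero +ᶻ 0ℤ *ᶻ sum (f ∘ suc)               ≡⟨ ℤ.+-identityʳ (f zero) ⟩
  f zero                                      ∎
  where open ≡-Reasoning
-- The head term computes to zero, and equality of successors computes to equality of predecessors,
-- so the tail is the sum for `i`.
sum-identity {suc n} (suc i) f = trans (ℤ.+-identityˡ _) (sum-identity i (f ∘ suc))

*-diag : ∀ {n} (v : Vector ℤ n) i j → v i *ᶻ identity i j ≡ diag v i j
*-diag v i j with does (i Fin.≟ j)
... | true  = ℤ.*-identityʳ (v i)
... | false = ℤ.*-zeroʳ (v i)

-- Diagonalising the lcm matrix

μpow : ℕ → ℕ → ℤ
μpow a n = μ n *ᶻ pow a n

-- Makes the entry a function of the numbers `x i` and `x j`, as `sum-support` requires.
B≡onQuotient : ∀ {n} a (x : Vector ℕ n) i j → B a x i j ≡ onQuotient (μpow a) (x i) (x j)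
B≡onQuotient a x i j with x i ∣? x j
... | yes _ = refl
... | no  _ = refl

module _ (a : ℕ) {n : ℕ} (x : Vector ℕ n) (0<x : ∀ i → 0 < x i)
         (x-inj : Injective _≡_ _≡_ x) (x-closed : FactorClosed (Range x)) where

  E : Matrix n
  E c k = onQuotient (pow a) (x c) (x k)

  -- Only numbers `x c * t` with `t ∣ r` contribute, and they lie in the set because it is factor
  -- closed. There the two powers multiply to the constant `pow a r`, which leaves the Möbius sum
  -- over the divisors of `r`.
  EB-∣ : ∀ c i r → x i ≡ r * x c → (E ⊗ B a x) c i ≡ pow a r *ᶻ Σμ r
  EB-∣ c i r xi≡ = begin
    sum (λ k → E c k *ᶻ B a x k i)          ≡⟨ sum-cong-≗ (λ k → cong (E c k *ᶻ_) (B≡onQuotient a x k i)) ⟩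
    sum (f ∘ x)                             ≡⟨ sum-support x-inj
                                                 (Unique.map⁺ (*-cancelˡ-≡ _ _ (x c) {{>-nonZero (0<x c)}}) (divisors-unique r))
                                                 interval⊆x f≡0 ⟩
    Σ[ map (x c *_) (divisors r) ] f        ≡⟨ Σ-map (x c *_) (divisors r) f ⟩
    Σ[ divisors r ] (f ∘ (x c *_))          ≡⟨ Σ-cong (λ d∈ → summand (∈-divisors⁻ r d∈)) ⟩
    Σ[ divisors r ] (λ d → pow a r *ᶻ onQuotient μ d r) ≡⟨ Σ-*ˡ (pow a r) (divisors r) (λ d → onQuotient μ d r) ⟩
    pow a r *ᶻ Σμ r                         ∎
    where
    open ≡-Reasoning
    f : ℕ → ℤ
    f d = onQuotient (pow a) (x c) d *ᶻ onQuotient (μpow a) d (x i)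
    0<r : 0 < r
    0<r = ∣⇒0< (0<x i) (divides (x c) (trans xi≡ (*-comm r (x c))))
    ∣xi : ∀ {t} → t ∣ r → x c * t ∣ x i
    ∣xi {t} t∣r = subst (x c * t ∣_) (trans (*-comm (x c) r) (sym xi≡)) (*-monoʳ-∣ (x c) t∣r)
    interval⊆x : ∀ {d} → d ∈ map (x c *_) (divisors r) → Range x d
    interval⊆x d∈ with t , t∈ , refl ← ∈-map⁻ (x c *_) d∈ =
      let d∣xi = ∣xi (∈-divisors⁻ r t∈) in x-closed (i , refl) (∣⇒0< (0<x i) d∣xi) d∣xi
    f≡0 : ∀ {d} → d ∉ map (x c *_) (divisors r) → f d ≡ 0ℤ
    f≡0 {d} d∉ with x c ∣? d
    ... | no _ = refl
    ... | yes (divides t refl) = trans (cong (pow a t *ᶻ_) (onQuotient-∤ (μpow a) d∤xi)) (ℤ.*-zeroʳ (pow a t))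
      where
      d∤xi : t * x c ∤ x i
      d∤xi d∣xi = d∉ (subst (_∈ map (x c *_) (divisors r)) (*-comm (x c) t)
        (∈-map⁺ (x c *_) (∈-divisors⁺ 0<r (*-cancelʳ-∣ (x c) {{>-nonZero (0<x c)}} (subst (t * x c ∣_) xi≡ d∣xi)))))
    regroup : ∀ u y z → u *ᶻ (y *ᶻ z) ≡ (z *ᶻ u) *ᶻ y
    regroup = solve-∀
    summand : ∀ {t} → t ∣ r → f (x c * t) ≡ pow a r *ᶻ onQuotient μ t r
    summand {t} t∣r@(divides q r≡) = begin
      onQuotient (pow a) (x c) (x c * t) *ᶻ onQuotient (μpow a) (x c * t) (x i)
        ≡⟨ cong₂ _*ᶻ_ (onQuotient-≡ (pow a) t (0<x c) (*-comm (x c) t))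
                      (onQuotient-≡ (μpow a) q (∣⇒0< (0<x i) (∣xi t∣r)) xi≡q*) ⟩
      pow a t *ᶻ (μ q *ᶻ pow a q)   ≡⟨ regroup (pow a t) (μ q) (pow a q) ⟩
      (pow a q *ᶻ pow a t) *ᶻ μ q   ≡⟨ cong₂ _*ᶻ_ (trans (cong (pow a) r≡) (pow-* a q t)) (onQuotient-≡ μ q (∣⇒0< 0<r t∣r) r≡) ⟨
      pow a r *ᶻ onQuotient μ t r   ∎
      where
      xi≡q* : x i ≡ q * (x c * t)
      xi≡q* = trans xi≡ (trans (cong (_* x c) r≡) (trans (*-assoc q t (x c)) (cong (q *_) (*-comm t (x c)))))

  -- A nonzero term would need `x c ∣ x k` and `x k ∣ x i`, against transitivity.
  EB-∤ : ∀ c i → x c ∤ x i → (E ⊗ B a x) c i ≡ 0ℤ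
  EB-∤ c i c∤i = begin
    sum (λ k → E c k *ᶻ B a x k i)  ≡⟨ sum-cong-≗ vanish ⟩
    sum {n} (λ _ → 0ℤ *ᶻ 0ℤ)        ≡⟨ *-distribˡ-sum {n} 0ℤ (λ _ → 0ℤ) ⟨
    0ℤ                              ∎
    where
    open ≡-Reasoning
    vanish : ∀ k → E c k *ᶻ B a x k i ≡ 0ℤ
    vanish k with x c ∣? x k
    ... | no _ = refl
    ... | yes c∣k = trans (cong (pow a (quotient c∣k) *ᶻ_)
      (trans (B≡onQuotient a x k i) (onQuotient-∤ (μpow a) (c∤i ∘ ∣-trans c∣k)))) (ℤ.*-zeroʳ (pow a (quotient c∣k)))

  -- On the diagonal the cofactor is 1 and `Σμ 1` computes to 1. Off it, injectivity of `x` excludes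
  -- the cofactor 1, so the Möbius sum vanishes.
  EB≡identity : ∀ c i → (E ⊗ B a x) c i ≡ identity c i
  EB≡identity c i with c Fin.≟ i
  ... | yes refl = trans (EB-∣ c c 1 (sym (*-identityˡ (x c))))
                     (cong (λ m → + m *ᶻ Σμ 1) (^-zeroˡ a))
  ... | no c≢i with x c ∣? x i
  ...   | no c∤i = EB-∤ c i c∤i
  ...   | yes (divides r xi≡) = trans (EB-∣ c i r xi≡)
      (trans (cong (pow a r *ᶻ_) (Σμ≡0 1<r)) (ℤ.*-zeroʳ (pow a r)))
    where
    1<r : 1 < r
    1<r = ≤∧≢⇒< (∣⇒0< (0<x i) (divides (x c) (trans xi≡ (*-comm r (x c)))))
                (λ { refl → c≢i (x-inj (sym (trans xi≡ (*-identityˡ (x c))))) })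

  -- The sum in `lcm≡Σ` runs over the divisors of the gcd. All of these lie in the factor closed
  -- set, and the remaining indices contribute zero.
  lcmMatrix≡ : ∀ k l → lcmMatrix a x k l ≡ sum λ c → E c k *ᶻ (diagonalEntry a (x c) *ᶻ E c l)
  lcmMatrix≡ k l = trans (lcm≡Σ a (0<x k) (0<x l)) (sym (sum-support x-inj (divisors-unique (gcd (x k) (x l))) divisors⊆x f≡0))
    where
    0<g = ∣⇒0< (0<x k) (gcd[m,n]∣m (x k) (x l))
    divisors⊆x : ∀ {d} → d ∈ divisors (gcd (x k) (x l)) → Range x d
    divisors⊆x d∈ = let d∣g = ∈-divisors⁻ _ d∈ in
      x-closed (k , refl) (∣⇒0< 0<g d∣g) (∣-trans d∣g (gcd[m,n]∣m (x k) (x l)))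
    f≡0 : ∀ {d} → d ∉ divisors (gcd (x k) (x l)) →
      onQuotient (pow a) d (x k) *ᶻ (diagonalEntry a d *ᶻ onQuotient (pow a) d (x l)) ≡ 0ℤ
    f≡0 {d} d∉ with d ∣? x k
    ... | no _ = refl
    ... | yes d∣k = trans (cong (λ z → pow a (quotient d∣k) *ᶻ (diagonalEntry a d *ᶻ z)) (onQuotient-∤ (pow a) d∤l))
        (trans (cong (pow a (quotient d∣k) *ᶻ_) (ℤ.*-zeroʳ (diagonalEntry a d))) (ℤ.*-zeroʳ (pow a (quotient d∣k))))
      where
      d∤l : d ∤ x l
      d∤l d∣l = d∉ (∈-divisors⁺ 0<g (gcd-greatest d∣k d∣l))

  -- After `lcmMatrix≡` and an exchange of the two sums, the inner sum is an entry of `E ⊗ B a x`,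
  -- which is the identity.
  BᵀL≡DE : ∀ i l → (transpose (B a x) ⊗ lcmMatrix a x) i l ≡ diagonalEntry a (x i) *ᶻ E i l
  BᵀL≡DE i l = begin
    sum (λ k → B a x k i *ᶻ lcmMatrix a x k l)
      ≡⟨ sum-cong-≗ (λ k → trans (cong (B a x k i *ᶻ_) (lcmMatrix≡ k l)) (*-distribˡ-sum (B a x k i) (λ c → E c k *ᶻ DE c))) ⟩
    sum (λ k → sum (λ c → B a x k i *ᶻ (E c k *ᶻ DE c)))
      ≡⟨ ∑-comm (λ k c → B a x k i *ᶻ (E c k *ᶻ DE c)) ⟩
    sum (λ c → sum (λ k → B a x k i *ᶻ (E c k *ᶻ DE c)))
      ≡⟨ sum-cong-≗ (λ c → trans (sum-cong-≗ (λ k → regroup (B a x k i) (E c k) (DE c)))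
                                 (sym (*-distribʳ-sum (DE c) (λ k → E c k *ᶻ B a x k i)))) ⟩
    sum (λ c → (E ⊗ B a x) c i *ᶻ DE c)
      ≡⟨ sum-cong-≗ (λ c → cong (_*ᶻ DE c) (EB≡identity c i)) ⟩
    sum (λ c → identity c i *ᶻ DE c)
      ≡⟨ sum-identity i DE ⟩
    DE i ∎
    where
    open ≡-Reasoning
    DE : Vector ℤ n
    DE c = diagonalEntry a (x c) *ᶻ E c l
    regroup : ∀ u y z → u *ᶻ (y *ᶻ z) ≡ (y *ᶻ u) *ᶻ z
    regroup = solve-∀

  -- The second use of `EB≡identity`, now for the right factor `B a x`.
  BᵀLB≡diag : ∀ i j → (transpose (B a x) ⊗ lcmMatrix a x ⊗ B a x) i j ≡ diag (diagonalEntry a ∘ x) i j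
  BᵀLB≡diag i j = begin
    sum (λ l → (transpose (B a x) ⊗ lcmMatrix a x) i l *ᶻ B a x l j)
      ≡⟨ sum-cong-≗ (λ l → trans (cong (_*ᶻ B a x l j) (BᵀL≡DE i l)) (ℤ.*-assoc (diagonalEntry a (x i)) (E i l) (B a x l j))) ⟩
    sum (λ l → diagonalEntry a (x i) *ᶻ (E i l *ᶻ B a x l j))
      ≡⟨ *-distribˡ-sum (diagonalEntry a (x i)) (λ l → E i l *ᶻ B a x l j) ⟨
    diagonalEntry a (x i) *ᶻ (E ⊗ B a x) i j
      ≡⟨ cong (diagonalEntry a (x i) *ᶻ_) (EB≡identity i j) ⟩
    diagonalEntry a (x i) *ᶻ identity i j
      ≡⟨ *-diag (diagonalEntry a ∘ x) i j ⟩
    diag (diagonalEntry a ∘ x) i j ∎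
    where open ≡-Reasoning

diag-cong : ∀ {n} {v w : Vector ℤ n} → (∀ i → v i ≡ w i) → ∀ i j → diag v i j ≡ diag w i j
diag-cong v≡w i j = cong (λ z → if does (i Fin.≟ j) then z else 0ℤ) (v≡w i)

theorem1p2 : (a m : ℕ) → 0 < a → (x : Vector ℕ (suc m)) →
    (∀ i → 0 < x i) → Injective _≡_ _≡_ x → FactorClosed (Range x) → x zero ≡ 1 →
    ∀ i j → (transpose (B a x) ⊗ lcmMatrix a x ⊗ B a x) i j ≡
    diag (1ℤ ∷ λ k → diagonalEntry a (x (suc k))) i j
theorem1p2 a m _ x 0<x x-inj x-closed x₀≡1 i j =
  trans (BᵀLB≡diag a x 0<x x-inj x-closed i j) (diag-cong entries i j)
  where
  entries : ∀ k → diagonalEntry a (x k) ≡ (1ℤ ∷ λ k → diagonalEntry a (x (suc k))) k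
  -- `diagonalEntry a 1` is an empty product and computes to `1ℤ`.
  entries zero    = cong (diagonalEntry a) x₀≡1
  entries (suc k) = refl
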